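{- Let $k\ge 1$ and $m\ge 2$ be integers, and let $G=(V,E)$ be a connected $m$-colorable graph on $n\ge 2$ vertices. Then the $k$-differential chromatic number of $G$ is at least $\left\lfloor\frac{(k-1)n}{m-1}\right\rfloor+1$.
   Context: Graphs are finite, simple and undirected. A graph is $m$-colorable if its vertices can be properly colored with at most $m$ colors. For an $n$-vertex graph $G=(V,E)$ and positive integers $d,k$, the graph $G$ is $(d,kn)$-differential colorable if there is an injective map $c:V\to\{1,\dots,kn\}$ such that $|c(u)-c(v)|\ge d$ for every edge $(u,v)\in E$. The $k$-differential chromatic number of $G$ is the largest $d$ such that $G$ is $(d,kn)$-differential colorable. -}

module Defs where

open import Data.Fin.Base using (Fin)
open import Data.Nat.Base using (ℕ; _*_; _≤_; ∣_-_∣)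
open import Data.Product.Base using (Σ-syntax)
open import Function.Definitions using (Injective)
open import Level using (0ℓ)
open import Relation.Binary.Construct.Closure.ReflexiveTransitive using (Star)
open import Relation.Binary.Core using (Rel)
open import Relation.Binary.Definitions using (Decidable; Irreflexive; Symmetric)
open import Relation.Binary.PropositionalEquality.Core using (_≡_; _≢_)

record Graph (n : ℕ) : Set₁ where
  field
    Adj        : Rel (Fin n) 0ℓ
    adj?       : Decidable Adj
    adj-sym    : Symmetric Adj
    adj-irrefl : Irreflexive _≡_ Adj

module _ {n : ℕ} (G : Graph n) where
  open Graph G

  Connected : Set
  Connected = ∀ u v → Star Adj u v

  -- The colour map need not be onto, so this is "at most m colours".
  Colorable : ℕ → Set
  Colorable m = Σ[ f ∈ (Fin n → Fin m) ] (∀ u v → Adj u v → f u ≢ f v)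

  record DifferentialColoring (d k : ℕ) : Set where
    field
      label           : Fin n → ℕ
      label-positive  : ∀ v → 1 ≤ label v
      label-bounded   : ∀ v → label v ≤ k * n
      label-injective : Injective _≡_ _≡_ label
      label-separated : ∀ u v → Adj u v → d ≤ ∣ label u - label v ∣

  -- d is the largest positive integer admitting a coloring; there is at
  -- most one such d, and none when G has no edges and k is positive.
  record IsDifferentialChromaticNumber (k d : ℕ) : Set where
    field
      positive : 1 ≤ d
      attained : DifferentialColoring d k
      largest  : ∀ d′ → 1 ≤ d′ → DifferentialColoring d′ k → d′ ≤ d

{-# OPTIONS --safe #-}
module Submission where

-- List the vertices colour class by colour class and give the vertex at position p
-- and of colour i the label p + i q, where q = ⌊(k-1)n/(m-1)⌋.  Labels are at most
-- n + (m-1) q ≤ kn, they strictly increase along the list, and between vertices of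
-- different colours both summands increase, so the gap there is at least q + 1.
-- The largest d exists because a connected graph on two vertices has an edge, which
-- bounds d by kn, and because (d, kn)-colourability is a finite search.

open import Defs
open import Data.Nat.Base using (ℕ; _+_; _*_; _∸_; _≤_; _/_; >-nonZero)
open import Data.Nat.Properties using (m<n⇒0<n∸m)
open import Data.Product.Base using (_×_; ∃-syntax)

open import Data.Bool.Base using (true)
open import Data.Fin.Base as Fin using (Fin; toℕ; fromℕ<; combine; finToFun; funToFin)
import Data.Fin.Properties as Fin
open import Data.Fin.Subset using (Subset; ∣_∣; _∈_; _∉_; ⊤)
open import Data.Fin.Subset.Properties using (p⊂q⇒∣p∣<∣q∣; ∈⊤; ∣⊤∣≡n)
open import Data.Nat.Base using (suc; _<_; z≤n; s≤s; ∣_-_∣; NonZero)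
open import Data.Nat.DivMod using (m/n*n≤m)
open import Data.Nat.Properties
open import Data.Product.Base using (∃; _,_; proj₁)
open import Data.Vec.Base using (tabulate)
open import Data.Vec.Properties using (lookup∘tabulate; lookup⇒[]=; []=⇒lookup)
open import Function.Base using (_∘_)
open import Relation.Binary.Construct.Closure.ReflexiveTransitive using (ε; _◅_)
open import Relation.Binary.Definitions using (tri<; tri≈; tri>)
open import Relation.Binary.PropositionalEquality
  using (_≡_; _≢_; _≗_; refl; sym; trans; cong; cong₂; subst)
open import Relation.Nullary using (Dec; yes; no; does; contradiction; map′; _×-dec_; _→-dec_)
open import Relation.Nullary.Decidable using (dec-true)
open import Relation.Unary using (Pred; Decidable)

-- Maxima of bounded predicates and finite search

-- Descending search from `b`: each failure of `P` lowers the bound by one, and the witness `p₀`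
-- excludes failure all the way down to 0.
∃-maximum : ∀ {p} {P : Pred ℕ p} → Decidable P → ∀ b → (∀ d → P d → d ≤ b) →
            ∀ {d₀} → P d₀ → ∃[ d ] (P d × (∀ d′ → P d′ → d′ ≤ d))
∃-maximum P? b bound p₀ with P? b
... | yes pb = b , pb , bound
∃-maximum {P = P} P? 0       bound p₀ | no ¬pb =
  contradiction (subst P (n≤0⇒n≡0 (bound _ p₀)) p₀) ¬pb
∃-maximum {P = P} P? (suc b) bound p₀ | no ¬pb = ∃-maximum P? b bound′ p₀
  where
  bound′ : ∀ d → P d → d ≤ b
  bound′ d pd = m<1+n⇒m≤n (≤∧≢⇒< (bound d pd) λ d≡1+b → ¬pb (subst P d≡1+b pd))

-- Maps with values at most `b` are coded by the finitely many elements of `Fin (suc b ^ n)`.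
-- Decoding recovers a map only pointwise, hence the hypothesis that `P` respects `≗`.
bounded-map? : ∀ {n p} {P : Pred (Fin n → ℕ) p} → Decidable P →
               (∀ {c c′} → c ≗ c′ → P c → P c′) →
               ∀ b → (∀ {c} → P c → ∀ v → c v ≤ b) → Dec (∃ P)
bounded-map? {n} {P = P} P? resp b bound = map′
  (λ (i , p) → toℕ ∘ finToFun i , p)
  (λ (c , p) → encode c p , resp (sym ∘ decode c p) p)
  (Fin.any? (λ i → P? (toℕ ∘ finToFun i)))
  where
  truncate : ∀ c → P c → Fin n → Fin (suc b)
  truncate c p v = fromℕ< (s≤s (bound p v))

  encode : ∀ c → P c → Fin _
  encode c p = funToFin (truncate c p)

  decode : ∀ c p → toℕ ∘ finToFun (encode c p) ≗ c
  decode c p v = trans (cong toℕ (Fin.finToFun-funToFin (truncate c p) v))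
                       (Fin.toℕ-fromℕ< _)

does-true⇒ : ∀ {a} {A : Set a} (a? : Dec A) → does a? ≡ true → A
does-true⇒ (yes a) _ = a

m+n≤o⇒n≤∣m-o∣ : ∀ m {n o} → m + n ≤ o → n ≤ ∣ m - o ∣
m+n≤o⇒n≤∣m-o∣ m {n} {o} m+n≤o = subst (n ≤_) (sym (m≤n⇒∣m-n∣≡n∸m (m+n≤o⇒m≤o m m+n≤o)))
  (m+n≤o⇒m≤o∸n n (subst (_≤ o) (+-comm m n) m+n≤o))

-- Deciding differential colourability, and the bound from an edge

module _ {n : ℕ} (G : Graph n) where
  open Graph G

  -- A predicate on the bare map, with explicit quantifiers over vertices, so that each clause is
  -- decided by `Fin.all?` and the whole fits `bounded-map?`.
  IsDifferentialLabelling : ℕ → ℕ → (Fin n → ℕ) → Set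
  IsDifferentialLabelling d k c =
    (∀ v → 1 ≤ c v) × (∀ v → c v ≤ k * n) × (∀ u v → c u ≡ c v → u ≡ v) ×
    (∀ u v → Adj u v → d ≤ ∣ c u - c v ∣)

  isDifferentialLabelling? : ∀ d k → Decidable (IsDifferentialLabelling d k)
  isDifferentialLabelling? d k c =
    Fin.all? (λ v → 1 ≤? c v) ×-dec
    Fin.all? (λ v → c v ≤? k * n) ×-dec
    Fin.all? (λ u → Fin.all? λ v → (c u ≟ c v) →-dec (u Fin.≟ v)) ×-dec
    Fin.all? (λ u → Fin.all? λ v → adj? u v →-dec (d ≤? ∣ c u - c v ∣))

  isDifferentialLabelling-resp : ∀ d k {c c′} → c ≗ c′ →
    IsDifferentialLabelling d k c → IsDifferentialLabelling d k c′
  isDifferentialLabelling-resp d k c≗c′ (pos , bound , inj , sep) =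
    (λ v → subst (1 ≤_) (c≗c′ v) (pos v)) ,
    (λ v → subst (_≤ k * n) (c≗c′ v) (bound v)) ,
    (λ u v eq → inj u v (trans (c≗c′ u) (trans eq (sym (c≗c′ v))))) ,
    (λ u v u~v → subst (d ≤_) (cong₂ ∣_-_∣ (c≗c′ u) (c≗c′ v)) (sep u v u~v))

  differentialColoring? : ∀ k → Decidable (λ d → DifferentialColoring G d k)
  differentialColoring? k d = map′
    (λ (c , pos , bound , inj , sep) → record
      { label           = c
      ; label-positive  = pos
      ; label-bounded   = bound
      ; label-injective = inj _ _
      ; label-separated = sep
      })
    (λ D → let open DifferentialColoring D in
      label , label-positive , label-bounded , (λ _ _ → label-injective) , label-separated)
    (bounded-map? (isDifferentialLabelling? d k) (isDifferentialLabelling-resp d k)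
      (k * n) (λ (_ , bound , _) → bound))

  -- A path between the distinct vertices 0 and 1 cannot be empty, so its first step is an edge.
  ∃-edge : 2 ≤ n → Connected G → ∃[ u ] ∃[ v ] Adj u v
  ∃-edge (s≤s (s≤s _)) connected with connected Fin.zero (Fin.suc Fin.zero)
  ... | u~v ◅ _ = _ , _ , u~v

  edge⇒d≤kn : ∀ {u v} → Adj u v → ∀ {d k} → DifferentialColoring G d k → d ≤ k * n
  edge⇒d≤kn {u} {v} u~v D = ≤-trans (label-separated u v u~v)
    (≤-trans (∣m-n∣≤m⊔n (label u) (label v)) (⊔-lub (label-bounded u) (label-bounded v)))
    where open DifferentialColoring D

-- Positions in a list sorted by a key

module Rank {n N : ℕ} (key : Fin n → Fin N) where

  below : Fin n → Subset n
  below v = tabulate λ u → does (key u Fin.<? key v)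

  rank : Fin n → ℕ
  rank v = ∣ below v ∣

  ∈-below⁺ : ∀ {u v} → key u Fin.< key v → u ∈ below v
  ∈-below⁺ {u} {v} u<v = lookup⇒[]= u (below v)
    (trans (lookup∘tabulate _ u) (dec-true (key u Fin.<? key v) u<v))

  ∈-below⁻ : ∀ {u v} → u ∈ below v → key u Fin.< key v
  ∈-below⁻ {u} {v} u∈ = does-true⇒ (key u Fin.<? key v)
    (trans (sym (lookup∘tabulate _ u)) ([]=⇒lookup u∈))

  v∉below : ∀ v → v ∉ below v
  v∉below v v∈ = <-irrefl refl (∈-below⁻ v∈)

  -- Transitivity gives the inclusion of `below u` in `below v`; it is strict because `u` lies in
  -- the second set but not in the first.
  rank-mono-< : ∀ {u v} → key u Fin.< key v → rank u < rank v
  rank-mono-< {u} {v} u<v = p⊂q⇒∣p∣<∣q∣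
    ((λ w∈ → ∈-below⁺ (<-trans (∈-below⁻ w∈) u<v)) , u , ∈-below⁺ u<v , v∉below u)

  rank<n : ∀ v → rank v < n
  rank<n v = subst (rank v <_) (∣⊤∣≡n n) (p⊂q⇒∣p∣<∣q∣ ((λ _ → ∈⊤) , v , ∈⊤ , v∉below v))

-- Labels spread out by colour class

module _ {n m : ℕ} (f : Fin n → Fin m) (q : ℕ) where

  -- Lexicographic order: colour first, with ties inside a class broken by the vertex index.
  colourKey : Fin n → Fin (m * n)
  colourKey v = combine (f v) v

  open Rank colourKey

  classLabel : Fin n → ℕ
  classLabel v = suc (rank v) + toℕ (f v) * q

  colourKey-injective : ∀ {u v} → colourKey u ≡ colourKey v → u ≡ v
  colourKey-injective {u} {v} = Fin.combine-injectiveʳ (f u) u (f v) v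

  colourKey-cancel-≤ : ∀ {u v} → colourKey u Fin.< colourKey v → toℕ (f u) ≤ toℕ (f v)
  colourKey-cancel-≤ {u} {v} u<v = ≮⇒≥ λ fv<fu →
    <-asym u<v (Fin.combine-monoˡ-< v u fv<fu)

  classLabel-mono-< : ∀ {u v} → colourKey u Fin.< colourKey v → classLabel u < classLabel v
  classLabel-mono-< u<v =
    +-mono-<-≤ (s≤s (rank-mono-< u<v)) (*-monoˡ-≤ q (colourKey-cancel-≤ u<v))

  classLabel-injective : ∀ {u v} → classLabel u ≡ classLabel v → u ≡ v
  classLabel-injective {u} {v} eq with Fin.<-cmp (colourKey u) (colourKey v)
  ... | tri< u<v _ _ = contradiction eq (<⇒≢ (classLabel-mono-< u<v))
  ... | tri≈ _ u≡v _ = colourKey-injective u≡v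
  ... | tri> _ _ v<u = contradiction (sym eq) (<⇒≢ (classLabel-mono-< v<u))

  -- Colours start at 0, so the last class is shifted by at most `m ∸ 1` copies of `q`; this is the
  -- source of the denominator.
  classLabel-bounded : ∀ v → classLabel v ≤ n + (m ∸ 1) * q
  classLabel-bounded v = +-mono-≤ (rank<n v) (*-monoˡ-≤ q (Fin.toℕ≤pred[n] (f v)))

  -- A larger colour contributes at least `q`, and the strictly later position contributes the extra
  -- 1.
  classLabel-gap : ∀ {u v} → f u Fin.< f v → classLabel u + (q + 1) ≤ classLabel v
  classLabel-gap {u} {v} fu<fv = begin
    suc (rank u) + i * q + (q + 1)     ≡⟨ cong (suc (rank u) + i * q +_) (+-comm q 1) ⟩
    suc (rank u) + i * q + suc q       ≡⟨ +-suc _ q ⟩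
    suc (suc (rank u) + i * q + q)     ≡⟨ cong suc (+-assoc (suc (rank u)) (i * q) q) ⟩
    suc (suc (rank u)) + (i * q + q)   ≡⟨ cong (suc (suc (rank u)) +_) (+-comm (i * q) q) ⟩
    suc (suc (rank u)) + suc i * q     ≤⟨ +-mono-≤ (s≤s (rank-mono-< (Fin.combine-monoˡ-< u v fu<fv)))
                                                   (*-monoˡ-≤ q fu<fv) ⟩
    suc (rank v) + toℕ (f v) * q       ∎
    where
    open ≤-Reasoning
    i = toℕ (f u)

  classLabel-separated : ∀ {u v} → f u ≢ f v → q + 1 ≤ ∣ classLabel u - classLabel v ∣
  classLabel-separated {u} {v} fu≢fv with Fin.<-cmp (f u) (f v)
  ... | tri< fu<fv _ _ = m+n≤o⇒n≤∣m-o∣ (classLabel u) (classLabel-gap fu<fv)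
  ... | tri≈ _ fu≡fv _ = contradiction fu≡fv fu≢fv
  ... | tri> _ _ fv<fu = subst (q + 1 ≤_) (∣-∣-comm (classLabel v) (classLabel u))
                           (m+n≤o⇒n≤∣m-o∣ (classLabel v) (classLabel-gap fv<fu))

colorable⇒differentialColoring : ∀ {n m} (G : Graph n) → Colorable G m →
  ∀ k q → n + (m ∸ 1) * q ≤ k * n → DifferentialColoring G (q + 1) k
colorable⇒differentialColoring G (f , proper) k q fits = record
  { label           = classLabel f q
  ; label-positive  = λ _ → s≤s z≤n
  ; label-bounded   = λ v → ≤-trans (classLabel-bounded f q v) fits
  ; label-injective = classLabel-injective f q
  ; label-separated = λ u v u~v → classLabel-separated f q (proper u v u~v)
  }

-- Applied with `m ∸ 1` for `m` and with `k` one less than the theorem's: the rounded-down quotient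
-- makes the largest label fit.
n+m*[kn/m]≤[1+k]*n : ∀ k m n .{{_ : NonZero m}} → n + m * ((k * n) / m) ≤ suc k * n
n+m*[kn/m]≤[1+k]*n k m n = +-monoʳ-≤ n
  (subst (_≤ k * n) (*-comm ((k * n) / m) m) (m/n*n≤m (k * n) m))

lemma3 : ∀ (k m n : ℕ) → 1 ≤ k → (2≤m : 2 ≤ m) → 2 ≤ n →
    (G : Graph n) → Connected G → Colorable G m →
    ∃[ χ ] (IsDifferentialChromaticNumber G k χ ×
    (_/_ ((k ∸ 1) * n) (m ∸ 1) {{>-nonZero (m<n⇒0<n∸m 2≤m)}} + 1 ≤ χ))
lemma3 (suc k) m n _ 2≤m 2≤n G connected colorable =
  -- Positivity comes from the summand 1 in `q + 1`, so it holds even when `q` is 0, as for palette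
  -- size exactly `n`.
  χ , record { positive = ≤-trans (m≤n+m 1 q) q+1≤χ
             ; attained = attained
             ; largest  = λ d _ → largest d
             } , q+1≤χ
  where
  instance
    m∸1≢0 : NonZero (m ∸ 1)
    m∸1≢0 = >-nonZero (m<n⇒0<n∸m 2≤m)

  q : ℕ
  q = (k * n) / (m ∸ 1)

  coloring : DifferentialColoring G (q + 1) (suc k)
  coloring = colorable⇒differentialColoring G colorable (suc k) q
    (n+m*[kn/m]≤[1+k]*n k (m ∸ 1) n)

  bound : ∀ d → DifferentialColoring G d (suc k) → d ≤ suc k * n
  bound d = let _ , _ , u~v = ∃-edge G 2≤n connected in edge⇒d≤kn G u~v

  maximum : ∃[ d ] (DifferentialColoring G d (suc k) ×
                    (∀ d′ → DifferentialColoring G d′ (suc k) → d′ ≤ d))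
  maximum = ∃-maximum (differentialColoring? G (suc k)) (suc k * n) bound coloring

  χ : ℕ
  χ = proj₁ maximum

  attained : DifferentialColoring G χ (suc k)
  attained = let _ , D , _ = maximum in D

  largest : ∀ d → DifferentialColoring G d (suc k) → d ≤ χ
  largest = let _ , _ , l = maximum in l

  q+1≤χ : q + 1 ≤ χ
  q+1≤χ = largest (q + 1) coloring
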